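{- $\mathrm{InqLTL}({\sim})$ is strictly less expressive than $\mathrm{TeamLTL}({\sim})$. That is: (i) for every nonempty finite set $AP$, each $\mathrm{InqLTL}({\sim})$ formula over $AP$ is equivalent to some $\mathrm{TeamLTL}({\sim})$ formula over $AP$; and (ii) there are a finite set $AP$ and a $\mathrm{TeamLTL}({\sim})$ formula over $AP$ that is not equivalent to any $\mathrm{InqLTL}({\sim})$ formula over $AP$.
   Context: For a finite set $AP$ of atomic propositions, a trace is an infinite word $w$ over $2^{AP}$; $w(i)$ ($i\ge 0$) is its $(i+1)$-th letter and $w_{\ge i}=w(i)w(i+1)\cdots$. A team is a (possibly empty) set $\mathcal L$ of traces, and $\mathcal L_{\ge i}=\{w_{\ge i}\mid w\in\mathcal L\}$. Two formulas are equivalent if they are satisfied by exactly the same teams. $\mathrm{InqLTL}({\sim})$ formulas: $\varphi::=\bot\mid p\mid \varphi\vee_b\varphi\mid\varphi\wedge\varphi\mid\varphi\to\varphi\mid \mathsf X\varphi\mid\varphi\,\mathsf U\,\varphi\mid\varphi\,\mathsf R\,\varphi\mid{\sim}\varphi$, with $p\in AP$. $\mathrm{TeamLTL}({\sim})$ formulas: $\varphi::=p\mid\neg p\mid\varphi\vee\varphi\mid\varphi\wedge\varphi\mid\mathsf X\varphi\mid\varphi\,\mathsf U\,\varphi\mid\varphi\,\mathsf R\,\varphi\mid{\sim}\varphi$, with $p\in AP$. Satisfaction by a team $\mathcal L$ (clauses for whichever logic has the operator): - $\mathcal L\models\bot$ iff $\mathcal L=\emptyset$; - $\mathcal L\models p$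 iff $p\in w(0)$ for each $w\in\mathcal L$; $\mathcal L\models\neg p$ (TeamLTL literal) iff $p\notin w(0)$ for each $w\in\mathcal L$; - $\mathcal L\models\varphi_1\vee\varphi_2$ (split disjunction) iff there are $\mathcal L_1,\mathcal L_2$ with $\mathcal L=\mathcal L_1\cup\mathcal L_2$, $\mathcal L_1\models\varphi_1$ and $\mathcal L_2\models\varphi_2$; - $\mathcal L\models\varphi_1\vee_b\varphi_2$ (Boolean disjunction) iff $\mathcal L\models\varphi_1$ or $\mathcal L\models\varphi_2$; - $\mathcal L\models\varphi_1\wedge\varphi_2$ iff $\mathcal L\models\varphi_1$ and $\mathcal L\models\varphi_2$; - $\mathcal L\models\varphi_1\to\varphi_2$ iff for all $\mathcal L'\subseteq\mathcal L$, $\mathcal L'\models\varphi_1$ implies $\mathcal L'\models\varphi_2$; - $\mathcal L\models\mathsf X\varphi$ iff $\mathcal L_{\ge1}\models\varphi$; - $\mathcal L\models\varphi_1\mathsf U\varphi_2$ iff for some $i\ge0$, $\mathcal L_{\ge i}\models\varphi_2$ and $\mathcal L_{\ge k}\models\varphi_1$ for all $0\le k<i$; - $\mathcal L\models\varphi_1\mathsf R\varphi_2$ iff for each $i\ge0$, $\mathcal L_{\ge i}\models\varphi_2$ or $\mathcal L_{\ge k}\models\varphi_1$ for some $0\le k<i$; - $\mathcal L\models{\sim}\varphi$ iff $\mathcal L\not\models\varphi$. -}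

module Defs where

open import Data.Fin.Base using (Fin)
open import Data.Fin.Subset using (Subset) renaming (_∈_ to _∈ˡ_; _∉_ to _∉ˡ_)
open import Data.Nat.Base using (ℕ; _+_; _<_)
open import Data.Product.Base using (∃; ∃-syntax; _×_; _,_)
open import Data.Sum.Base using (_⊎_)
open import Function.Bundles using (_⇔_)
open import Level using (Lift; 0ℓ; suc)
open import Relation.Binary.Definitions using (_Respects_)
open import Relation.Binary.PropositionalEquality using (_≗_; sym; trans)
open import Relation.Nullary.Negation.Core using (¬_)
open import Relation.Unary using (Pred; Empty; _⊆_; _∪_; _≐_; _∈_)

-- The finite set AP of atomic propositions is Fin n, so 2^AP is Subset n.

Trace : ℕ → Set
Trace n = ℕ → Subset n

suffix : ∀ {n} → ℕ → Trace n → Trace n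
suffix i w = λ k → w (i + k)

-- Two traces are the same word when they agree pointwise.  Function
-- extensionality is not available, so a set of traces has to be a
-- predicate that respects this equality.

record Team (n : ℕ) : Set₁ where
  constructor mkTeam
  field
    traces : Pred (Trace n) 0ℓ
    resp   : traces Respects _≗_

open Team public

infixl 30 _≥[_]

_≥[_] : ∀ {n} → Team n → ℕ → Team n
L ≥[ i ] = record
  { traces = λ v → ∃[ w ] (w ∈ traces L × v ≗ suffix i w)
  ; resp   = λ { v≗v′ (w , w∈L , v≗) →
                 w , w∈L , λ k → trans (sym (v≗v′ k)) (v≗ k) }
  }

infix  9 ~_ X_
infixr 8 _U_ _R_
infixr 7 _∧_
infixr 6 _∨_ _∨ᵇ_
infixr 5 _⇒_

data InqLTL (n : ℕ) : Set where
  bot  : InqLTL n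
  atom : Fin n → InqLTL n
  _∨ᵇ_ : InqLTL n → InqLTL n → InqLTL n
  _∧_  : InqLTL n → InqLTL n → InqLTL n
  _⇒_  : InqLTL n → InqLTL n → InqLTL n
  X_   : InqLTL n → InqLTL n
  _U_  : InqLTL n → InqLTL n → InqLTL n
  _R_  : InqLTL n → InqLTL n → InqLTL n
  ~_   : InqLTL n → InqLTL n

data TeamLTL (n : ℕ) : Set where
  atom  : Fin n → TeamLTL n
  natom : Fin n → TeamLTL n
  _∨_   : TeamLTL n → TeamLTL n → TeamLTL n
  _∧_   : TeamLTL n → TeamLTL n → TeamLTL n
  X_    : TeamLTL n → TeamLTL n
  _U_   : TeamLTL n → TeamLTL n → TeamLTL n
  _R_   : TeamLTL n → TeamLTL n → TeamLTL n
  ~_    : TeamLTL n → TeamLTL n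

infix 4 _⊨ᴵ_ _⊨ᵀ_ _≡ᶠ_

_⊨ᴵ_ : ∀ {n} → Team n → InqLTL n → Set₁
L ⊨ᴵ bot    = Lift (suc 0ℓ) (Empty (traces L))
L ⊨ᴵ atom p = Lift (suc 0ℓ) (∀ w → w ∈ traces L → p ∈ˡ w 0)
L ⊨ᴵ φ ∨ᵇ ψ = (L ⊨ᴵ φ) ⊎ (L ⊨ᴵ ψ)
L ⊨ᴵ φ ∧ ψ  = (L ⊨ᴵ φ) × (L ⊨ᴵ ψ)
L ⊨ᴵ φ ⇒ ψ  = ∀ L′ → traces L′ ⊆ traces L → L′ ⊨ᴵ φ → L′ ⊨ᴵ ψ
L ⊨ᴵ X φ    = L ≥[ 1 ] ⊨ᴵ φ
L ⊨ᴵ φ U ψ  = ∃[ i ] ((L ≥[ i ] ⊨ᴵ ψ) × (∀ k → k < i → L ≥[ k ] ⊨ᴵ φ))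
L ⊨ᴵ φ R ψ  = ∀ i → (L ≥[ i ] ⊨ᴵ ψ) ⊎ (∃[ k ] (k < i × (L ≥[ k ] ⊨ᴵ φ)))
L ⊨ᴵ ~ φ    = ¬ (L ⊨ᴵ φ)

_⊨ᵀ_ : ∀ {n} → Team n → TeamLTL n → Set₁
L ⊨ᵀ atom p  = Lift (suc 0ℓ) (∀ w → w ∈ traces L → p ∈ˡ w 0)
L ⊨ᵀ natom p = Lift (suc 0ℓ) (∀ w → w ∈ traces L → p ∉ˡ w 0)
L ⊨ᵀ φ ∨ ψ   = ∃[ L₁ ] ∃[ L₂ ]
  ((traces L ≐ traces L₁ ∪ traces L₂) × (L₁ ⊨ᵀ φ) × (L₂ ⊨ᵀ ψ))
L ⊨ᵀ φ ∧ ψ   = (L ⊨ᵀ φ) × (L ⊨ᵀ ψ)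
L ⊨ᵀ X φ     = L ≥[ 1 ] ⊨ᵀ φ
L ⊨ᵀ φ U ψ   = ∃[ i ] ((L ≥[ i ] ⊨ᵀ ψ) × (∀ k → k < i → L ≥[ k ] ⊨ᵀ φ))
L ⊨ᵀ φ R ψ   = ∀ i → (L ≥[ i ] ⊨ᵀ ψ) ⊎ (∃[ k ] (k < i × (L ≥[ k ] ⊨ᵀ φ)))
L ⊨ᵀ ~ φ     = ¬ (L ⊨ᵀ φ)

_≡ᶠ_ : ∀ {n} → InqLTL n → TeamLTL n → Set₁
φ ≡ᶠ ψ = ∀ L → (L ⊨ᴵ φ) ⇔ (L ⊨ᵀ ψ)

{-# OPTIONS --safe #-}
-- (i) A subteam of L is exactly a team L₁ with L = L₁ ∪ L, so the split
-- disjunction with a tautology is quantification over subteams, and → is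
-- obtained from it by negation.
--
-- (ii) Let interval m consist of the traces over {p} in which p occurs at most
-- once, and then before position m.  These teams increase with m, and the i-th
-- suffix of interval m is interval (m ∸ i).  Hence every InqLTL(~) formula is
-- eventually constant along this chain: an implication is antitone in m, and
-- U and R inherit the property through their one-step unfolding.  The TeamLTL(~)
-- formula α ∨ β, where α (resp. β) says that the positions at which p occurs
-- form a word in (10)*11 0^ω (resp. (01)*0^ω), holds in interval m for even
-- m ≥ 2 and fails for odd m.
module Submission where

open import Defs
open import Axiom.DoubleNegationElimination using (em⇒dne)
open import Axiom.ExcludedMiddle using (ExcludedMiddle)
open import Data.Fin.Base using (Fin; zero)
open import Data.Fin.Subset using (⁅_⁆) renaming (_∈_ to _∈ˡ_; _∉_ to _∉ˡ_; ⊥ to ∅ˡ)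
open import Data.Fin.Subset.Properties using (x∈⁅x⁆; ∉⊥)
open import Data.Nat.Base
  using (ℕ; zero; suc; _+_; _*_; _∸_; _⊔_; _≤_; _<_; _≤′_; ≤′-refl; ≤′-step;
         z≤n; s≤s; parity; NonZero)
open import Data.Nat.Properties
  using (_≟_; _<?_; ≤-refl; ≤-trans; ≤-antisym; ≤⇒≤′; ≤′⇒≤; <⇒≤; n≤1+n; n≮n;
         ≮⇒≥; m≤m+n; m≤m*n; m⊔n≤o⇒m≤o; m⊔n≤o⇒n≤o; m≤n⇒m<n∨m≡n; m≤n⇒∃[o]m+o≡n;
         +-identityʳ; +-comm; +-suc; +-cancelˡ-≡)
open import Data.Parity.Base using (0ℙ; 1ℙ; _⁻¹)
open import Data.Parity.Properties using (suc-homo-⁻¹; ⁻¹-involutive; p≢p⁻¹)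
open import Data.Product.Base using (∃; ∃-syntax; _×_; _,_; proj₁; proj₂)
open import Data.Product.Function.NonDependent.Propositional using (_×-⇔_)
open import Data.Sum.Base using (_⊎_; inj₁; inj₂; [_,_])
open import Data.Sum.Function.Propositional using (_⊎-⇔_)
open import Function.Base using (id; _∘_)
open import Function.Bundles using (_⇔_; mk⇔; Equivalence)
open import Function.Properties.Equivalence using ()
  renaming (refl to ⇔-refl; sym to ⇔-sym; trans to ⇔-trans)
open import Function.Related.TypeIsomorphisms using (¬-cong-⇔)
open import Level using (0ℓ; lift; lower) renaming (suc to lsuc)
open import Relation.Binary.PropositionalEquality
  using (_≡_; _≗_; refl; sym; trans; cong; subst)
open import Relation.Nullary using (¬_; yes; no; contradiction)
open import Relation.Nullary.Decidable.Core using (map′)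
open import Relation.Unary using (Pred; _⊆_; _∪_; _≐_; _∈_)
open import Relation.Unary.Properties using (≐-trans)

open Equivalence using (to; from)

-- Translation of InqLTL(~) into TeamLTL(~)

Until Release : (A B : ℕ → Set₁) → Set₁
Until   A B = ∃[ i ] (B i × (∀ k → k < i → A k))
Release A B = ∀ i → B i ⊎ (∃[ k ] (k < i × A k))

Until-cong : ∀ {A A′ B B′ : ℕ → Set₁} → (∀ i → A i ⇔ A′ i) → (∀ i → B i ⇔ B′ i) →
             Until A B ⇔ Until A′ B′
Until-cong A⇔ B⇔ = mk⇔
  (λ (i , b , a) → i , to (B⇔ i) b , λ k k<i → to (A⇔ k) (a k k<i))
  (λ (i , b , a) → i , from (B⇔ i) b , λ k k<i → from (A⇔ k) (a k k<i))

Release-cong : ∀ {A A′ B B′ : ℕ → Set₁} → (∀ i → A i ⇔ A′ i) → (∀ i → B i ⇔ B′ i) →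
               Release A B ⇔ Release A′ B′
Release-cong A⇔ B⇔ = mk⇔
  (λ r i → to (B⇔ i ⊎-⇔ ∃<-cong) (r i))
  (λ r i → from (B⇔ i ⊎-⇔ ∃<-cong) (r i))
  where
  ∃<-cong : ∀ {i} → (∃[ k ] (k < i × _)) ⇔ (∃[ k ] (k < i × _))
  ∃<-cong = mk⇔ (λ (k , k<i , a) → k , k<i , to (A⇔ k) a)
                (λ (k , k<i , a) → k , k<i , from (A⇔ k) a)

-- The grammar has no constants, so truth and falsity are built from some proposition `p`; this is
-- where `AP` has to be nonempty.
⊤ᵀ : ∀ {n} → Fin n → TeamLTL n
⊤ᵀ p = ~ (atom p ∧ ~ atom p)

translate : ∀ {n} → Fin n → InqLTL n → TeamLTL n
translate p bot      = atom p ∧ natom p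
translate p (atom q) = atom q
translate p (φ ∨ᵇ ψ) = ~ (~ translate p φ ∧ ~ translate p ψ)
translate p (φ ∧ ψ)  = translate p φ ∧ translate p ψ
translate p (φ ⇒ ψ)  = ~ ((translate p φ ∧ ~ translate p ψ) ∨ ⊤ᵀ p)
translate p (X φ)    = X translate p φ
translate p (φ U ψ)  = translate p φ U translate p ψ
translate p (φ R ψ)  = translate p φ R translate p ψ
translate p (~ φ)    = ~ translate p φ

module _ (em : ExcludedMiddle (lsuc 0ℓ)) where

  -- Induction for all teams at once, since subformulas are evaluated at suffixes and subteams.
  -- Double negation elimination enters where `∨ᵇ` and `⇒` are expressed through `~`.
  translate-correct : ∀ {n} (p : Fin n) φ → φ ≡ᶠ translate p φ
  translate-correct p bot L = mk⇔
    (λ (lift e) → lift (λ w w∈L → contradiction w∈L (e w)) ,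
                  lift (λ w w∈L → contradiction w∈L (e w)))
    (λ (lift a , lift b) → lift λ w w∈L → b w w∈L (a w w∈L))
  translate-correct p (atom q) L = ⇔-refl
  translate-correct p (φ ∨ᵇ ψ) L = mk⇔
    [ (λ a (¬a , _) → ¬a (to (translate-correct p φ L) a))
    , (λ b (_ , ¬b) → ¬b (to (translate-correct p ψ L) b)) ]
    (λ ¬[¬a×¬b] → em⇒dne em λ ¬[a⊎b] → ¬[¬a×¬b]
      ( (λ a → ¬[a⊎b] (inj₁ (from (translate-correct p φ L) a)))
      , (λ b → ¬[a⊎b] (inj₂ (from (translate-correct p ψ L) b)))))
  translate-correct p (φ ∧ ψ) L = translate-correct p φ L ×-⇔ translate-correct p ψ L
  translate-correct p (φ ⇒ ψ) L = mk⇔ sound complete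
    where
    sound : L ⊨ᴵ (φ ⇒ ψ) → L ⊨ᵀ translate p (φ ⇒ ψ)
    sound f (L₁ , L₂ , (_ , L₁∪L₂⊆L) , (a , ¬b) , _) =
      ¬b (to (translate-correct p ψ L₁)
             (f L₁ (L₁∪L₂⊆L ∘ inj₁) (from (translate-correct p φ L₁) a)))

    complete : L ⊨ᵀ translate p (φ ⇒ ψ) → L ⊨ᴵ (φ ⇒ ψ)
    complete ¬split L₁ L₁⊆L a = em⇒dne em λ ¬b → ¬split
      ( L₁ , L
      , (inj₂ , λ { (inj₁ w∈L₁) → L₁⊆L w∈L₁ ; (inj₂ w∈L) → w∈L })
      , (to (translate-correct p φ L₁) a , ¬b ∘ from (translate-correct p ψ L₁))
      , λ (a , ¬a) → ¬a a)
  translate-correct p (X φ) L = translate-correct p φ (L ≥[ 1 ])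
  translate-correct p (φ U ψ) L =
    Until-cong (λ i → translate-correct p φ (L ≥[ i ])) (λ i → translate-correct p ψ (L ≥[ i ]))
  translate-correct p (φ R ψ) L =
    Release-cong (λ i → translate-correct p φ (L ≥[ i ])) (λ i → translate-correct p ψ (L ≥[ i ]))
  translate-correct p (~ φ) L = ¬-cong-⇔ (translate-correct p φ L)

-- Invariance of satisfaction under equality of trace sets

≥-cong : ∀ {n} (L M : Team n) → traces L ≐ traces M →
         ∀ i → traces (L ≥[ i ]) ≐ traces (M ≥[ i ])
≥-cong L M (L⊆M , M⊆L) i = (λ (w , w∈L , eq) → w , L⊆M w∈L , eq)
                         , (λ (w , w∈M , eq) → w , M⊆L w∈M , eq)

-- Implication already quantifies over subteams, so it is downward closed even when `φ` and `ψ`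
-- contain `~`.
⇒-restrict : ∀ {n} (φ ψ : InqLTL n) (L M : Team n) → traces M ⊆ traces L →
             L ⊨ᴵ (φ ⇒ ψ) → M ⊨ᴵ (φ ⇒ ψ)
⇒-restrict φ ψ L M M⊆L f L′ L′⊆M = f L′ (M⊆L ∘ L′⊆M)

-- Lets a suffix of a team in the chain be replaced by the chain member with the same traces, which
-- is a different record.
⊨ᴵ-resp-≐ : ∀ {n} (φ : InqLTL n) (L M : Team n) → traces L ≐ traces M →
            (L ⊨ᴵ φ) ⇔ (M ⊨ᴵ φ)
⊨ᴵ-resp-≐ bot L M (L⊆M , M⊆L) = mk⇔ (λ (lift e) → lift λ w → e w ∘ M⊆L)
                                    (λ (lift e) → lift λ w → e w ∘ L⊆M)
⊨ᴵ-resp-≐ (atom q) L M (L⊆M , M⊆L) = mk⇔ (λ (lift e) → lift λ w → e w ∘ M⊆L)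
                                         (λ (lift e) → lift λ w → e w ∘ L⊆M)
⊨ᴵ-resp-≐ (φ ∨ᵇ ψ) L M L≐M = ⊨ᴵ-resp-≐ φ L M L≐M ⊎-⇔ ⊨ᴵ-resp-≐ ψ L M L≐M
⊨ᴵ-resp-≐ (φ ∧ ψ) L M L≐M = ⊨ᴵ-resp-≐ φ L M L≐M ×-⇔ ⊨ᴵ-resp-≐ ψ L M L≐M
⊨ᴵ-resp-≐ (φ ⇒ ψ) L M (L⊆M , M⊆L) =
  mk⇔ (⇒-restrict φ ψ L M M⊆L) (⇒-restrict φ ψ M L L⊆M)
⊨ᴵ-resp-≐ (X φ) L M L≐M = ⊨ᴵ-resp-≐ φ (L ≥[ 1 ]) (M ≥[ 1 ]) (≥-cong L M L≐M 1)
⊨ᴵ-resp-≐ (φ U ψ) L M L≐M =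
  Until-cong (λ i → ⊨ᴵ-resp-≐ φ (L ≥[ i ]) (M ≥[ i ]) (≥-cong L M L≐M i))
             (λ i → ⊨ᴵ-resp-≐ ψ (L ≥[ i ]) (M ≥[ i ]) (≥-cong L M L≐M i))
⊨ᴵ-resp-≐ (φ R ψ) L M L≐M =
  Release-cong (λ i → ⊨ᴵ-resp-≐ φ (L ≥[ i ]) (M ≥[ i ]) (≥-cong L M L≐M i))
               (λ i → ⊨ᴵ-resp-≐ ψ (L ≥[ i ]) (M ≥[ i ]) (≥-cong L M L≐M i))
⊨ᴵ-resp-≐ (~ φ) L M L≐M = ¬-cong-⇔ (⊨ᴵ-resp-≐ φ L M L≐M)

-- Eventually constant predicates on ℕ

EventuallyTrue EventuallyFalse EventuallyConstant : (ℕ → Set₁) → Set₁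
EventuallyTrue     P = ∃[ N ] (∀ n → N ≤ n → P n)
EventuallyFalse    P = EventuallyTrue (λ n → ¬ P n)
EventuallyConstant P = EventuallyTrue P ⊎ EventuallyFalse P

eventuallyConstant-⇔ : ∀ {P Q : ℕ → Set₁} → (∀ n → P n ⇔ Q n) →
                       EventuallyConstant P → EventuallyConstant Q
eventuallyConstant-⇔ P⇔Q (inj₁ (N , p))  = inj₁ (N , λ n N≤n → to (P⇔Q n) (p n N≤n))
eventuallyConstant-⇔ P⇔Q (inj₂ (N , ¬p)) = inj₂ (N , λ n N≤n → ¬p n N≤n ∘ from (P⇔Q n))

eventuallyConstant-pred : ∀ {P : ℕ → Set₁} → EventuallyConstant P →
                          EventuallyConstant (λ n → P (n ∸ 1))
eventuallyConstant-pred (inj₁ (N , p))  = inj₁ (suc N , λ { _ (s≤s N≤n) → p _ N≤n })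
eventuallyConstant-pred (inj₂ (N , ¬p)) = inj₂ (suc N , λ { _ (s≤s N≤n) → ¬p _ N≤n })

eventuallyConstant-¬ : ∀ {P : ℕ → Set₁} → EventuallyConstant P →
                       EventuallyConstant (λ n → ¬ P n)
eventuallyConstant-¬ (inj₁ (N , p))  = inj₂ (N , λ n N≤n ¬p → ¬p (p n N≤n))
eventuallyConstant-¬ (inj₂ (N , ¬p)) = inj₁ (N , ¬p)

eventuallyConstant-× : ∀ {P Q : ℕ → Set₁} → EventuallyConstant P → EventuallyConstant Q →
                       EventuallyConstant (λ n → P n × Q n)
eventuallyConstant-× (inj₂ (N , ¬p)) _ = inj₂ (N , λ n N≤n → ¬p n N≤n ∘ proj₁)
eventuallyConstant-× (inj₁ _) (inj₂ (N , ¬q)) = inj₂ (N , λ n N≤n → ¬q n N≤n ∘ proj₂)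
eventuallyConstant-× (inj₁ (M , p)) (inj₁ (N , q)) =
  inj₁ (M ⊔ N , λ n h → p n (m⊔n≤o⇒m≤o M N h) , q n (m⊔n≤o⇒n≤o M N h))

eventuallyConstant-⊎ : ∀ {P Q : ℕ → Set₁} → EventuallyConstant P → EventuallyConstant Q →
                       EventuallyConstant (λ n → P n ⊎ Q n)
eventuallyConstant-⊎ (inj₁ (N , p)) _ = inj₁ (N , λ n N≤n → inj₁ (p n N≤n))
eventuallyConstant-⊎ (inj₂ _) (inj₁ (N , q)) = inj₁ (N , λ n N≤n → inj₂ (q n N≤n))
eventuallyConstant-⊎ (inj₂ (M , ¬p)) (inj₂ (N , ¬q)) =
  inj₂ (M ⊔ N , λ n h → [ ¬p n (m⊔n≤o⇒m≤o M N h) , ¬q n (m⊔n≤o⇒n≤o M N h) ])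

-- Time runs backwards: the i-th suffix of the n-th team of the chain below is
-- its (n ∸ i)-th team.
UntilFrom : (A B : ℕ → Set₁) → ℕ → Set₁
UntilFrom A B n = Until (λ i → A (n ∸ i)) (λ i → B (n ∸ i))

ascend : ∀ {P : ℕ → Set₁} {N} → (∀ n → N ≤ n → P n → P (suc n)) →
         ∀ {n} → N ≤′ n → P N → P n
ascend step ≤′-refl         x = x
ascend step (≤′-step N≤′n) x = step _ (≤′⇒≤ N≤′n) (ascend step N≤′n x)

module _ (em : ExcludedMiddle (lsuc 0ℓ)) where

  -- One failure persists upwards; without any failure the predicate is true from 0 on.
  eventuallyConstant-antitone : ∀ {P : ℕ → Set₁} → (∀ n → P (suc n) → P n) →
                                EventuallyConstant P
  eventuallyConstant-antitone {P} down with em {∃[ n ] ¬ P n}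
  ... | yes (N , ¬p) = inj₂ (N , λ n N≤n → ascend (λ n _ ¬p → ¬p ∘ down n) (≤⇒≤′ N≤n) ¬p)
  ... | no ¬∃        = inj₁ (0 , λ n _ → em⇒dne em λ ¬p → ¬∃ (n , ¬p))

  -- If `B` is eventually true, time 0 is a witness; if both are eventually false, time 0 refutes.
  -- Otherwise `A` is eventually true and `B` eventually false, so by the one-step unfolding the
  -- values at `n` and `suc n` agree past both thresholds, and the value at `M ⊔ N` persists.
  eventuallyConstant-Until : ∀ {A B : ℕ → Set₁} → EventuallyConstant A → EventuallyConstant B →
    EventuallyConstant (UntilFrom A B)
  eventuallyConstant-Until _ (inj₁ (N , b)) = inj₁ (N , λ n N≤n → 0 , b n N≤n , λ _ ())
  eventuallyConstant-Until (inj₂ (M , ¬a)) (inj₂ (N , ¬b)) = inj₂ (M ⊔ N , λ where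
    n h (zero  , b , _) → ¬b n (m⊔n≤o⇒n≤o M N h) b
    n h (suc i , _ , a) → ¬a n (m⊔n≤o⇒m≤o M N h) (a 0 (s≤s z≤n)))
  eventuallyConstant-Until {A} {B} (inj₁ (M , a)) (inj₂ (N , ¬b))
    with em {UntilFrom A B (M ⊔ N)}
  ... | yes f = inj₁ (M ⊔ N , λ n h → ascend up (≤⇒≤′ h) f)
    where
    up : ∀ n → M ⊔ N ≤ n → UntilFrom A B n → UntilFrom A B (suc n)
    up n h (i , b , a′) = suc i , b , λ where
      zero    _         → a (suc n) (≤-trans (m⊔n≤o⇒m≤o M N h) (n≤1+n n))
      (suc k) (s≤s k<i) → a′ k k<i
  ... | no ¬f = inj₂ (M ⊔ N , λ n h → ascend down (≤⇒≤′ h) ¬f)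
    where
    down : ∀ n → M ⊔ N ≤ n → ¬ UntilFrom A B n → ¬ UntilFrom A B (suc n)
    down n h _  (zero  , b , _)  = ¬b (suc n) (≤-trans (m⊔n≤o⇒n≤o M N h) (n≤1+n n)) b
    down n h ¬f (suc i , b , a′) = ¬f (i , b , λ k k<i → a′ (suc k) (s≤s k<i))

  ¬Until¬⇔Release : ∀ {A B : ℕ → Set₁} → (¬ Until (λ i → ¬ A i) (λ i → ¬ B i)) ⇔ Release A B
  ¬Until¬⇔Release = mk⇔
    (λ ¬u i → em⇒dne em λ ¬r → ¬u (i , ¬r ∘ inj₁ , λ k k<i a → ¬r (inj₂ (k , k<i , a))))
    (λ r (i , ¬b , ¬a) → [ ¬b , (λ (k , k<i , a) → ¬a k k<i a) ] (r i))

  -- InqLTL(~) along an increasing chain closed under suffixes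

  module _ {n : ℕ} (L : ℕ → Team n)
           (L-mono : ∀ m → traces (L m) ⊆ traces (L (suc m)))
           (L-suffix : ∀ m i → traces (L m ≥[ i ]) ≐ traces (L (m ∸ i))) where

    private
      unshift : ∀ φ m i → (L (m ∸ i) ⊨ᴵ φ) ⇔ (L m ≥[ i ] ⊨ᴵ φ)
      unshift φ m i = ⇔-sym (⊨ᴵ-resp-≐ φ (L m ≥[ i ]) (L (m ∸ i)) (L-suffix m i))

    ⊨ᴵ-eventuallyConstant : ∀ φ → EventuallyConstant (λ m → L m ⊨ᴵ φ)
    ⊨ᴵ-eventuallyConstant bot =
      eventuallyConstant-antitone λ m (lift e) → lift λ w → e w ∘ L-mono m
    ⊨ᴵ-eventuallyConstant (atom q) =
      eventuallyConstant-antitone λ m (lift e) → lift λ w → e w ∘ L-mono m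
    ⊨ᴵ-eventuallyConstant (φ ∨ᵇ ψ) =
      eventuallyConstant-⊎ (⊨ᴵ-eventuallyConstant φ) (⊨ᴵ-eventuallyConstant ψ)
    ⊨ᴵ-eventuallyConstant (φ ∧ ψ) =
      eventuallyConstant-× (⊨ᴵ-eventuallyConstant φ) (⊨ᴵ-eventuallyConstant ψ)
    ⊨ᴵ-eventuallyConstant (φ ⇒ ψ) =
      eventuallyConstant-antitone λ m → ⇒-restrict φ ψ (L (suc m)) (L m) (L-mono m)
    ⊨ᴵ-eventuallyConstant (X φ) =
      eventuallyConstant-⇔ (λ m → unshift φ m 1)
        (eventuallyConstant-pred (⊨ᴵ-eventuallyConstant φ))
    ⊨ᴵ-eventuallyConstant (φ U ψ) =
      eventuallyConstant-⇔ (λ m → Until-cong (unshift φ m) (unshift ψ m))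
        (eventuallyConstant-Until (⊨ᴵ-eventuallyConstant φ) (⊨ᴵ-eventuallyConstant ψ))
    ⊨ᴵ-eventuallyConstant (φ R ψ) =
      -- Release is treated as the dual of until, so its constancy comes from that of `UntilFrom` on
      -- the negated arguments.
      eventuallyConstant-⇔
        (λ m → ⇔-trans ¬Until¬⇔Release (Release-cong (unshift φ m) (unshift ψ m)))
        (eventuallyConstant-¬ (eventuallyConstant-Until
          (eventuallyConstant-¬ (⊨ᴵ-eventuallyConstant φ))
          (eventuallyConstant-¬ (⊨ᴵ-eventuallyConstant ψ))))
    ⊨ᴵ-eventuallyConstant (~ φ) = eventuallyConstant-¬ (⊨ᴵ-eventuallyConstant φ)

-- Teams of traces with at most one occurrence of the proposition

sparse : Pred ℕ 0ℓ → Team 1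
sparse Q = record
  { traces = λ w → (∀ k → zero ∈ˡ w k → k ∈ Q) ×
                   (∀ k l → zero ∈ˡ w k → zero ∈ˡ w l → k ≡ l)
  ; resp   = λ {w} {w′} w≗w′ (w⊆Q , unique) →
      let ∈w = λ k → subst (zero ∈ˡ_) (sym (w≗w′ k)) in
      (λ k → w⊆Q k ∘ ∈w k) , (λ k l k∈ l∈ → unique k l (∈w k k∈) (∈w l l∈))
  }

single : ℕ → Trace 1
single k j with j ≟ k
... | yes _ = ⁅ zero ⁆
... | no  _ = ∅ˡ

single-∈ : ∀ k → zero ∈ˡ single k k
single-∈ k with k ≟ k
... | yes _   = x∈⁅x⁆ zero
... | no  k≢k = contradiction refl k≢k

single-unique : ∀ k j → zero ∈ˡ single k j → j ≡ k
single-unique k j j∈ with j ≟ k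
... | yes j≡k = j≡k
... | no  _   = contradiction j∈ ∉⊥

single-sparse : ∀ {Q k} → k ∈ Q → single k ∈ traces (sparse Q)
single-sparse {Q} {k} k∈Q =
  (λ j j∈ → subst Q (sym (single-unique k j j∈)) k∈Q) ,
  (λ j l j∈ l∈ → trans (single-unique k j j∈) (sym (single-unique k l l∈)))

sparse-mono : ∀ {Q S} → Q ⊆ S → traces (sparse Q) ⊆ traces (sparse S)
sparse-mono Q⊆S (w⊆Q , unique) = (λ k k∈ → Q⊆S (w⊆Q k k∈)) , unique

delay : ℕ → Trace 1 → Trace 1
delay zero    v         = v
delay (suc i) v zero    = ∅ˡ
delay (suc i) v (suc k) = delay i v k

delay-suffix : ∀ i v → v ≗ suffix i (delay i v)
delay-suffix zero    v k = refl
delay-suffix (suc i) v k = delay-suffix i v k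

delay-∈ : ∀ i v k → zero ∈ˡ delay i v k → ∃[ j ] (i + j ≡ k × zero ∈ˡ v j)
delay-∈ zero    v k       k∈ = k , refl , k∈
delay-∈ (suc i) v zero    k∈ = contradiction k∈ ∉⊥
delay-∈ (suc i) v (suc k) k∈ =
  let j , i+j≡k , j∈ = delay-∈ i v k k∈ in j , cong suc i+j≡k , j∈

-- For the converse inclusion a trace is delayed by `i` empty letters: these add no occurrence, so
-- uniqueness survives.
sparse-≥ : ∀ Q i → traces (sparse Q ≥[ i ]) ≐ traces (sparse (λ k → i + k ∈ Q))
sparse-≥ Q i = suffixes , delays
  where
  suffixes : traces (sparse Q ≥[ i ]) ⊆ traces (sparse (λ k → i + k ∈ Q))
  suffixes (w , (w⊆Q , unique) , v≗) =
    (λ k k∈ → w⊆Q (i + k) (subst (zero ∈ˡ_) (v≗ k) k∈)) ,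
    (λ k l k∈ l∈ → +-cancelˡ-≡ i k l (unique (i + k) (i + l)
      (subst (zero ∈ˡ_) (v≗ k) k∈) (subst (zero ∈ˡ_) (v≗ l) l∈)))

  delays : traces (sparse (λ k → i + k ∈ Q)) ⊆ traces (sparse Q ≥[ i ])
  delays {v} (v⊆Q , unique) = delay i v , (delay⊆Q , delay-unique) , delay-suffix i v
    where
    delay⊆Q : ∀ k → zero ∈ˡ delay i v k → k ∈ Q
    delay⊆Q k k∈ with delay-∈ i v k k∈
    ... | j , refl , j∈ = v⊆Q j j∈

    delay-unique : ∀ k l → zero ∈ˡ delay i v k → zero ∈ˡ delay i v l → k ≡ l
    delay-unique k l k∈ l∈ with delay-∈ i v k k∈ | delay-∈ i v l l∈
    ... | j , refl , j∈ | j′ , refl , j′∈ = cong (i +_) (unique j j′ j∈ j′∈)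

-- The single occurrence in a trace decides which part it goes to; a trace without occurrence lies
-- in both. Uniqueness is essential: several occurrences could be spread over `Q` and `S`.
sparse-∪ : ExcludedMiddle 0ℓ → ∀ {P Q S : Pred ℕ 0ℓ} → P ≐ Q ∪ S →
           traces (sparse P) ≐ traces (sparse Q) ∪ traces (sparse S)
sparse-∪ em {P} {Q} {S} (P⊆Q∪S , Q∪S⊆P) =
  split , λ { (inj₁ w∈) → sparse-mono {Q} {P} (Q∪S⊆P ∘ inj₁) w∈
            ; (inj₂ w∈) → sparse-mono {S} {P} (Q∪S⊆P ∘ inj₂) w∈ }
  where
  split : traces (sparse P) ⊆ traces (sparse Q) ∪ traces (sparse S)
  split {w} (w⊆P , unique) with em {∃[ k ] zero ∈ˡ w k}
  ... | no ¬∃ = inj₁ ((λ k k∈ → contradiction (k , k∈) ¬∃) , unique)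
  ... | yes (k , k∈) with P⊆Q∪S (w⊆P k k∈)
  ...   | inj₁ k∈Q = inj₁ ((λ l l∈ → subst Q (unique k l k∈ l∈) k∈Q) , unique)
  ...   | inj₂ k∈S = inj₂ ((λ l l∈ → subst S (unique k l k∈ l∈) k∈S) , unique)

-- The chain of intervals

interval : ℕ → Team 1
interval m = sparse (_< m)

+-<⇔<-∸ : ∀ i k m → (i + k < m) ⇔ (k < m ∸ i)
+-<⇔<-∸ zero    k m       = ⇔-refl
+-<⇔<-∸ (suc i) k zero    = mk⇔ (λ ()) (λ ())
+-<⇔<-∸ (suc i) k (suc m) = ⇔-trans (mk⇔ (λ { (s≤s h) → h }) s≤s) (+-<⇔<-∸ i k m)

interval-mono : ∀ m → traces (interval m) ⊆ traces (interval (suc m))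
interval-mono m = sparse-mono {_< m} {_< suc m} (λ k<m → ≤-trans k<m (n≤1+n m))

-- Truncated subtraction is right here: from `i = m` on only the trace without occurrences is left,
-- which is `interval 0`.
interval-≥ : ∀ m i → traces (interval m ≥[ i ]) ≐ traces (interval (m ∸ i))
interval-≥ m i = ≐-trans (sparse-≥ (_< m) i)
  ( sparse-mono {λ k → i + k < m} {_< m ∸ i} (λ {k} → to (+-<⇔<-∸ i k m))
  , sparse-mono {_< m ∸ i} {λ k → i + k < m} (λ {k} → from (+-<⇔<-∸ i k m)))

-- The formulas and what they say about occupied positions

Absent : Team 1 → Pred ℕ 0ℓ
Absent L k = ∀ w → w ∈ traces L → zero ∉ˡ w k

absent-sparse : ∀ {Q} k → Absent (sparse Q) k ⇔ (¬ k ∈ Q)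
absent-sparse k = mk⇔
  (λ absent k∈Q → absent (single k) (single-sparse k∈Q) (single-∈ k))
  (λ k∉Q w (w⊆Q , _) k∈ → k∉Q (w⊆Q k k∈))

-- The position is given up to an equation, so that `k + 0` and `k + 1` can be passed as `k` and
-- `suc k`.
absent-≥ : ∀ L i {j k} → i + j ≡ k → Absent (L ≥[ i ]) j ⇔ Absent L k
absent-≥ L i {j} refl = mk⇔
  (λ absent w w∈L → absent (suffix i w) (w , w∈L , λ _ → refl))
  (λ absent v (w , w∈L , v≗) j∈ → absent w w∈L (subst (zero ∈ˡ_) (v≗ j) j∈))

-- A contradiction on the left turns `R` into "always". `alternates` is the exclusive or of `absent`
-- now and next. The target of `U` in `α` is the first letter of the closing 11, in `β` the start of
-- the empty tail.
absent never alternates α β : TeamLTL 1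
absent     = natom zero
never      = (atom zero ∧ ~ atom zero) R absent
alternates = ~ (absent ∧ X absent) ∧ ~ (~ absent ∧ ~ X absent)
α          = ~ absent ∧ (alternates U (~ absent ∧ X (~ absent ∧ X never)))
β          = absent ∧ (alternates U never)

Alternates : Pred ℕ 0ℓ → Pred ℕ 0ℓ
Alternates A k = ¬ (A k × A (suc k)) × ¬ (¬ A k × ¬ A (suc k))

⊨absent : ∀ L → (L ⊨ᵀ absent) ⇔ Absent L 0
⊨absent L = mk⇔ lower lift

≥⊨absent : ∀ L k → (L ≥[ k ] ⊨ᵀ absent) ⇔ Absent L k
≥⊨absent L k = ⇔-trans (⊨absent (L ≥[ k ])) (absent-≥ L k (+-identityʳ k))

≥⊨Xabsent : ∀ L k → (L ≥[ k ] ⊨ᵀ X absent) ⇔ Absent L (suc k)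
≥⊨Xabsent L k = ⇔-trans (≥⊨absent (L ≥[ k ]) 1) (absent-≥ L k (+-comm k 1))

≥⊨alternates : ∀ L k → (L ≥[ k ] ⊨ᵀ alternates) ⇔ Alternates (Absent L) k
≥⊨alternates L k =
  ¬-cong-⇔ (≥⊨absent L k ×-⇔ ≥⊨Xabsent L k) ×-⇔
  ¬-cong-⇔ (¬-cong-⇔ (≥⊨absent L k) ×-⇔ ¬-cong-⇔ (≥⊨Xabsent L k))

⊨never : ∀ L → (L ⊨ᵀ never) ⇔ (∀ k → Absent L k)
⊨never L = mk⇔
  (λ r k → to (≥⊨absent L k) ([ id , (λ (_ , _ , a , ¬a) → contradiction a ¬a) ] (r k)))
  (λ absent k → inj₁ (from (≥⊨absent L k) (absent k)))

≥-absentFrom : ∀ L i → (∀ k → Absent (L ≥[ i ]) k) ⇔ (∀ k → i ≤ k → Absent L k)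
≥-absentFrom L i = mk⇔ there
  (λ absent k → from (absent-≥ L i refl) (absent (i + k) (m≤m+n i k)))
  where
  there : (∀ k → Absent (L ≥[ i ]) k) → ∀ k → i ≤ k → Absent L k
  there absent k i≤k with m≤n⇒∃[o]m+o≡n i≤k
  ... | j , i+j≡k = to (absent-≥ L i i+j≡k) (absent j)

≥⊨never : ∀ L i → (L ≥[ i ] ⊨ᵀ never) ⇔ (∀ k → i ≤ k → Absent L k)
≥⊨never L i = ⇔-trans (⊨never (L ≥[ i ])) (≥-absentFrom L i)

-- Iterated suffixes are not the same team as one long suffix, so they are compared position by
-- position through `Absent`.
≥⊨XXnever : ∀ L i → (L ≥[ i ] ⊨ᵀ X X never) ⇔ (∀ k → suc (suc i) ≤ k → Absent L k)
≥⊨XXnever L i =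
  ⇔-trans (⊨never (L ≥[ i ] ≥[ 1 ] ≥[ 1 ])) (⇔-trans drop (≥-absentFrom L (suc (suc i))))
  where
  i+2+k≡2+i+k : ∀ k → i + suc (suc k) ≡ suc (suc i) + k
  i+2+k≡2+i+k k = trans (+-suc i (suc k)) (cong suc (+-suc i k))

  step : ∀ k → Absent (L ≥[ i ] ≥[ 1 ] ≥[ 1 ]) k ⇔ Absent (L ≥[ suc (suc i) ]) k
  step k = ⇔-trans (absent-≥ (L ≥[ i ] ≥[ 1 ]) 1 refl)
          (⇔-trans (absent-≥ (L ≥[ i ]) 1 refl)
          (⇔-trans (absent-≥ L i (i+2+k≡2+i+k k))
                   (⇔-sym (absent-≥ L (suc (suc i)) refl))))

  drop : (∀ k → Absent (L ≥[ i ] ≥[ 1 ] ≥[ 1 ]) k) ⇔ (∀ k → Absent (L ≥[ suc (suc i) ]) k)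
  drop = mk⇔ (λ absent k → to (step k) (absent k)) (λ absent k → from (step k) (absent k))

-- Alternation and parity

parity-suc : ∀ k {q} → parity (suc k) ≡ q → parity k ≡ q ⁻¹
parity-suc k eq = trans (sym (suc-homo-⁻¹ k)) (cong _⁻¹ eq)

parity-either : ∀ k q → parity k ≡ q ⊎ parity (suc k) ≡ q
parity-either k q with parity k in eq | parity (suc k) in eq′ | q
... | 0ℙ | _  | 0ℙ = inj₁ refl
... | 1ℙ | _  | 1ℙ = inj₁ refl
... | _  | 0ℙ | 0ℙ = inj₂ refl
... | _  | 1ℙ | 1ℙ = inj₂ refl
... | 1ℙ | 1ℙ | 0ℙ = contradiction (trans (sym eq) (parity-suc k eq′)) λ ()
... | 0ℙ | 0ℙ | 1ℙ = contradiction (trans (sym eq) (parity-suc k eq′)) λ ()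

-- Exactly one of `k` and `suc k` has parity `q`, and `k < i` keeps both in the range where `Q` is
-- described.
sparse-alternates : ∀ {Q q i} → (∀ k → k ≤ i → k ∈ Q ⇔ parity k ≡ q) →
                    ∀ k → k < i → Alternates (Absent (sparse Q)) k
sparse-alternates {Q} {q} Q⇔ k k<i =
  (λ (a , a′) → [ (λ e → to (absent-sparse k) a (from (Q⇔ k (<⇒≤ k<i)) e))
                , (λ e → to (absent-sparse (suc k)) a′ (from (Q⇔ (suc k) k<i) e))
                ] (parity-either k q)) ,
  (λ (¬a , ¬a′) →
    ¬a (from (absent-sparse k) λ k∈Q →
    ¬a′ (from (absent-sparse (suc k)) λ k′∈Q →
    p≢p⁻¹ q (trans (sym (to (Q⇔ k (<⇒≤ k<i)) k∈Q)) (parity-suc k (to (Q⇔ (suc k) k<i) k′∈Q))))))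

module _ (em : ExcludedMiddle 0ℓ) where

  -- Alternation propagates the status of position 0: parity `q` means occupied, the other parity
  -- empty. It is applied with `q = 0ℙ` for `α` and `q = 1ℙ` for `β`, whose first position is empty.
  alternates-parity : ∀ {A q i} → (∀ k → k < i → Alternates A k) →
    (0ℙ ≡ q → ¬ A 0) × (0ℙ ≡ q ⁻¹ → A 0) →
    ∀ k → k ≤ i → (parity k ≡ q → ¬ A k) × (parity k ≡ q ⁻¹ → A k)
  alternates-parity alt base zero    _   = base
  alternates-parity {q = q} alt base (suc k) k<i =
    let occupied , empty = alternates-parity alt base k (<⇒≤ k<i)
        ¬both , ¬neither = alt k k<i
    in (λ e a′ → ¬both (empty (parity-suc k e) , a′))
     , (λ e → em⇒dne em λ ¬a′ →
          ¬neither (occupied (trans (parity-suc k e) (⁻¹-involutive q)) , ¬a′))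

  -- Since 0 is occupied, alternation leaves the odd positions up to `i` empty; the target `i` is
  -- occupied, hence even. So the last occupied position is odd.
  ⊨α⇒ : ∀ L → L ⊨ᵀ α →
        ∃[ i ] (parity i ≡ 0ℙ × ¬ Absent L (suc i) × (∀ k → suc (suc i) ≤ k → Absent L k))
  ⊨α⇒ L (¬a₀ , i , (¬aᵢ , ¬a′ , end) , alt) with parity i in eq
  ... | 0ℙ = i , eq , ¬a′ ∘ from (≥⊨Xabsent L i) , to (≥⊨XXnever L i) end
  ... | 1ℙ = contradiction (from (≥⊨absent L i) (proj₂ par eq)) ¬aᵢ
    where
    par : (parity i ≡ 0ℙ → ¬ Absent L i) × (parity i ≡ 1ℙ → Absent L i)
    par = alternates-parity (λ k k<i → to (≥⊨alternates L k) (alt k k<i))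
            ((λ _ → ¬a₀ ∘ from (⊨absent L)) , λ ()) i ≤-refl

  -- Before the target, alternation from an empty position 0 keeps even positions empty; from the
  -- target on everything is empty.
  ⊨β⇒ : ∀ L → L ⊨ᵀ β → ∀ k → parity k ≡ 0ℙ → Absent L k
  ⊨β⇒ L (a₀ , i , end , alt) k k-even with k <? i
  ... | no  k≮i = to (≥⊨never L i) end k (≮⇒≥ k≮i)
  ... | yes k<i =
    proj₂ (alternates-parity (λ k k<i → to (≥⊨alternates L k) (alt k k<i))
            ((λ ()) , λ _ → to (⊨absent L) a₀) k (<⇒≤ k<i)) k-even

  -- The part satisfying `α` stops at the odd position `suc i`. As `m` is odd, the even position
  -- `suc (suc i)` is still below `m`, yet the `α` part has ended there and the `β` part avoids even
  -- positions.
  odd⇒⊭α∨β : ∀ m → parity m ≡ 1ℙ → ¬ (interval m ⊨ᵀ α ∨ β)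
  odd⇒⊭α∨β m m-odd (L₁ , L₂ , (⊆∪ , ∪⊆) , ⊨α , ⊨β) with ⊨α⇒ L₁ ⊨α
  ... | i , i-even , ¬absent , end with suc i <? m
  ...   | no 1+i≮m = ¬absent λ w w∈L₁ k∈ → 1+i≮m (proj₁ (∪⊆ (inj₁ w∈L₁)) (suc i) k∈)
  ...   | yes 1+i<m with m≤n⇒m<n∨m≡n 1+i<m
  ...     | inj₂ refl = contradiction (trans (sym i-even) m-odd) λ ()
  ...     | inj₁ 2+i<m with ⊆∪ (single-sparse {_< m} 2+i<m)
  ...       | inj₁ ∈L₁ = end (suc (suc i)) ≤-refl _ ∈L₁ (single-∈ (suc (suc i)))
  ...       | inj₂ ∈L₂ = ⊨β⇒ L₂ ⊨β (suc (suc i)) i-even _ ∈L₂ (single-∈ (suc (suc i)))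

  -- Positions are split by parity, except that the last one, the odd `suc i`, joins the even ones
  -- and forms the closing 11 with `i`. Both formulas take `i` as the target of `U`.
  even⇒⊨α∨β : ∀ i → parity i ≡ 0ℙ → interval (suc (suc i)) ⊨ᵀ α ∨ β
  even⇒⊨α∨β i i-even =
    sparse Q₁ , sparse Q₂ , sparse-∪ em (cover , covered) , ⊨α , ⊨β
    where
    Q₁ Q₂ : Pred ℕ 0ℓ
    Q₁ k = (k ≤ i × parity k ≡ 0ℙ) ⊎ k ≡ suc i
    Q₂ k = k ≤ i × parity k ≡ 1ℙ

    cover : (_< suc (suc i)) ⊆ Q₁ ∪ Q₂
    cover {k} (s≤s k≤1+i) with m≤n⇒m<n∨m≡n k≤1+i
    ... | inj₂ k≡1+i = inj₁ (inj₂ k≡1+i)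
    ... | inj₁ (s≤s k≤i) with parity k
    ...   | 0ℙ = inj₁ (inj₁ (k≤i , refl))
    ...   | 1ℙ = inj₂ (k≤i , refl)

    covered : Q₁ ∪ Q₂ ⊆ (_< suc (suc i))
    covered (inj₁ (inj₁ (k≤i , _))) = s≤s (≤-trans k≤i (n≤1+n i))
    covered (inj₁ (inj₂ refl))      = ≤-refl
    covered (inj₂ (k≤i , _))        = s≤s (≤-trans k≤i (n≤1+n i))

    present : ∀ {Q} k → k ∈ Q → ¬ Absent (sparse Q) k
    present k k∈Q a = to (absent-sparse k) a k∈Q

    ⊨α : sparse Q₁ ⊨ᵀ α
    ⊨α = present 0 (inj₁ (z≤n , refl)) ∘ to (⊨absent L) , i ,
         ( present i (inj₁ (≤-refl , i-even)) ∘ to (≥⊨absent L i)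
         , present (suc i) (inj₂ refl) ∘ to (≥⊨Xabsent L i)
         , from (≥⊨XXnever L i) end ) ,
         λ k k<i → from (≥⊨alternates L k) (sparse-alternates Q₁⇔ k k<i)
      where
      L : Team 1
      L = sparse Q₁

      end : ∀ k → suc (suc i) ≤ k → Absent L k
      end k 2+i≤k = from (absent-sparse k) λ k∈Q₁ → n≮n k (≤-trans (covered (inj₁ k∈Q₁)) 2+i≤k)

      Q₁⇔ : ∀ k → k ≤ i → k ∈ Q₁ ⇔ parity k ≡ 0ℙ
      Q₁⇔ k k≤i = mk⇔
        [ proj₂ , (λ { refl → contradiction k≤i (n≮n i) }) ]
        (λ k-even → inj₁ (k≤i , k-even))

    ⊨β : sparse Q₂ ⊨ᵀ β
    ⊨β = from (⊨absent L) (from (absent-sparse 0) λ ()) , i ,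
         from (≥⊨never L i) end ,
         λ k k<i → from (≥⊨alternates L k)
           (sparse-alternates (λ k k≤i → mk⇔ proj₂ (k≤i ,_)) k k<i)
      where
      L : Team 1
      L = sparse Q₂

      end : ∀ k → i ≤ k → Absent L k
      -- Only `k = i` remains, and `i` is even.
      end k i≤k = from (absent-sparse k) λ (k≤i , k-odd) →
        contradiction (trans (sym i-even) (trans (cong parity (≤-antisym i≤k k≤i)) k-odd)) λ ()

-- Failure of eventual constancy and the theorem

parity-*2 : ∀ k → parity (k * 2) ≡ 0ℙ
parity-*2 zero    = refl
parity-*2 (suc k) = parity-*2 k

-- Any threshold `N` is passed by the odd number `2N + 1`, where the formula fails, and by the even
-- number `2N + 2`, where it holds.
α∨β-notEventuallyConstant : ExcludedMiddle 0ℓ → ¬ EventuallyConstant (λ m → interval m ⊨ᵀ α ∨ β)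
α∨β-notEventuallyConstant em (inj₁ (N , true)) =
  odd⇒⊭α∨β em (suc (N * 2))
    (trans (sym (⁻¹-involutive _)) (cong _⁻¹ (trans (suc-homo-⁻¹ (N * 2)) (parity-*2 N))))
    (true _ (≤-trans (m≤m*n N 2) (n≤1+n _)))
α∨β-notEventuallyConstant em (inj₂ (N , false)) =
  false _ (≤-trans (m≤m*n N 2) (≤-trans (n≤1+n _) (n≤1+n _)))
    (even⇒⊨α∨β em (N * 2) (parity-*2 N))

proposition3 : ExcludedMiddle (lsuc 0ℓ) →
    (∀ (n : ℕ) → .{{_ : NonZero n}} → (φ : InqLTL n) → ∃[ ψ ] (φ ≡ᶠ ψ))
    × (∃[ n ] ∃ λ (ψ : TeamLTL n) → ¬ (∃[ φ ] (φ ≡ᶠ ψ)))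
proposition3 em =
  (λ { (suc _) φ → translate zero φ , translate-correct em zero φ }) ,
  1 , α ∨ β , λ (φ , φ≡α∨β) →
    α∨β-notEventuallyConstant em₀
      (eventuallyConstant-⇔ (λ m → φ≡α∨β (interval m))
        (⊨ᴵ-eventuallyConstant em interval interval-mono interval-≥ φ))
  where
  em₀ : ExcludedMiddle 0ℓ
  em₀ = map′ lower lift em
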